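{- For every integer $\Delta \geq 5$ there exist infinitely many (pairwise non-isomorphic) connected graphs $G$ of maximum degree $\Delta$ that are neither regular nor biregular of class 1 and that satisfy the Zagreb indices equality $$\frac{M_1(G)}{n} = \frac{M_2(G)}{m},$$ where $n$ and $m$ are the numbers of vertices and edges of $G$.
   Context: Graphs are finite and simple. For a graph $G=(V,E)$ with $n=|V|$ vertices and $m=|E|$ edges, $d(v)$ denotes the degree of the vertex $v$; the first and second Zagreb indices are $M_1(G)=\sum_{v\in V} d(v)^2$ and $M_2(G)=\sum_{uv\in E} d(u)d(v)$. A graph is regular if all its vertices have the same degree. A graph is biregular if its vertex degrees assume exactly two distinct values; it is biregular of class 1 if, in addition, no two vertices of the same degree are adjacent. -}

module Defs where

open import Data.Bool.Base using (if_then_else_)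
open import Data.Fin.Base using (Fin)
open import Data.Fin.Permutation using (Permutation; _⟨$⟩ʳ_)
open import Data.Fin.Properties using (_<?_)
open import Data.Integer.Base using (+_)
open import Data.Nat.Base using (ℕ; _*_; _^_; _≤_; NonZero)
open import Data.Nat.Properties using (+-0-commutativeMonoid)
open import Data.Product.Base using (_×_; ∃-syntax)
open import Data.Rational.Base using (_/_)
open import Data.Sum.Base using (_⊎_)
open import Function.Bundles using (_⇔_)
open import Level using (0ℓ)
open import Relation.Binary.Construct.Closure.ReflexiveTransitive using (Star)
open import Relation.Binary.Core using (Rel)
open import Relation.Binary.Definitions using (Decidable; Irreflexive; Symmetric)
open import Relation.Binary.PropositionalEquality.Core using (_≡_; _≢_)
open import Relation.Nullary.Decidable.Core using (does; _×-dec_)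

open import Algebra.Properties.CommutativeMonoid.Sum +-0-commutativeMonoid
  using (sum-syntax)

record Graph : Set₁ where
  infix 4 _~_ _~?_
  field
    order    : ℕ
    _~_      : Rel (Fin order) 0ℓ
    _~?_     : Decidable _~_
    ~-sym    : Symmetric _~_
    ~-irrefl : Irreflexive _≡_ _~_

  Vertex : Set
  Vertex = Fin order

  degree : Vertex → ℕ
  degree v = ∑[ u < order ] (if does (v ~? u) then 1 else 0)

  -- Each edge {u , v} is counted once, as the pair with u < v.
  sumOverEdges : (Vertex → Vertex → ℕ) → ℕ
  sumOverEdges f =
    ∑[ u < order ] ∑[ v < order ]
      (if does ((u <? v) ×-dec (u ~? v)) then f u v else 0)

  size : ℕ
  size = sumOverEdges (λ _ _ → 1)

  M₁ : ℕ
  M₁ = ∑[ v < order ] (degree v ^ 2)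

  M₂ : ℕ
  M₂ = sumOverEdges (λ u v → degree u * degree v)

  Connected : Set
  Connected = ∀ u v → Star _~_ u v

  MaximumDegree : ℕ → Set
  MaximumDegree Δ = (∀ v → degree v ≤ Δ) × (∃[ v ] degree v ≡ Δ)

  Regular : Set
  Regular = ∀ u v → degree u ≡ degree v

  Biregular : Set
  Biregular = ∃[ a ] ∃[ b ]
    a ≢ b
    × (∃[ v ] degree v ≡ a)
    × (∃[ v ] degree v ≡ b)
    × (∀ v → degree v ≡ a ⊎ degree v ≡ b)

  BiregularClass1 : Set
  BiregularClass1 = Biregular × (∀ u v → u ~ v → degree u ≢ degree v)

  -- The first two fields say that both quotients are defined.
  record ZagrebEquality : Set where
    field
      {{order≢0}} : NonZero order
      {{size≢0}}  : NonZero size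
      equality    : (+ M₁) / order ≡ (+ M₂) / size

open Graph

infix 4 _≅_

record _≅_ (G H : Graph) : Set where
  field
    bijection : Permutation (order G) (order H)
    adjacency : ∀ u v → _~_ G u v ⇔ _~_ H (bijection ⟨$⟩ʳ u) (bijection ⟨$⟩ʳ v)

{-# OPTIONS --safe #-}

-- Let e = 2 M₂ and s = 2 m, so that the equality reads n e = s M₁.  As a quadratic
-- form in the numbers of edges of each degree type, n e − s M₁ vanishes on a single
-- type; a pair of types contributes positively as a rule, but negatively for edges
-- of type (5,2) against edges of type (3,3).  So string together in a row x "lenses"
-- (all edges of type (5,2)), y "diamonds" (fans with hub of degree 3, all edges of
-- type (3,3)) and f fans whose hub has degree Δ and whose rim vertices have degree 3,
-- and close the row by a leaf on the left and, on the right, by a vertex of degree 2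
-- followed by a leaf.  The equality is then linear in y, with leading coefficient
-- 2x − 6(Δ−3)²f − 78; an x making this coefficient 2 leaves, for even f, a natural
-- number y as the solution, and f is arbitrarily large.

module Submission where

open import Defs
open import Data.Bool.Base using (Bool; true; false; _∧_; if_then_else_; T)
open import Data.Bool.Properties using (∧-comm; T-∧)
open import Data.Empty using (⊥-elim)
open import Data.Fin.Base using (Fin; zero; suc; splitAt)
open import Data.Fin.Permutation using (↔⇒≡)
open import Data.Fin.Properties using (_<?_; +↔⊎)
import Data.Fin.Base as Fin using (_<_)
import Data.Fin.Properties as Fin using (<-cmp)
import Data.Integer.Base as ℤ
import Data.Integer.Properties as ℤ
open import Data.Nat.Base using (ℕ; zero; suc; _+_; _*_; _^_; _≤_; _<_; NonZero; z≤n; s≤s; >-nonZero)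
open import Data.Nat.Properties hiding (_<?_)
open import Data.Nat.Tactic.RingSolver using (solve-∀)
open import Data.Product.Base using (_×_; Σ-syntax; _,_)
open import Data.Rational.Base using (_/_)
open import Data.Rational.Properties using (fromℚᵘ-cong)
open import Data.Rational.Unnormalised.Base using (mkℚᵘ; *≡*)
open import Data.Sum.Base using (_⊎_; inj₁; inj₂; map; map₁)
open import Data.Sum.Function.Propositional using (_⊎-↔_)
open import Function.Base using (_∘_; id)
open import Function.Bundles using (_↔_; Inverse; Equivalence)
open import Function.Construct.Composition using (_↔-∘_)
open import Function.Construct.Identity using (↔-id)
open import Relation.Binary.Construct.Closure.ReflexiveTransitive using (Star; ε; _◅_; _◅◅_; gmap; reverse)
open import Relation.Binary.Definitions using (tri<; tri≈; tri>)
open import Relation.Binary.PropositionalEquality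
open import Relation.Nullary.Decidable.Core using (Dec; does; yes; no; T?; _×-dec_)
open import Relation.Nullary.Negation.Core using (¬_)
open import Algebra.Properties.Semiring.Sum +-*-semiring
  using (sum; sum-syntax; sum-cong-≗; sum-replicate-zero; ∑-distrib-+; ∑-comm; *-distribˡ-sum; *-distribʳ-sum)

open ≡-Reasoning

-- Boolean indicators and finite sums

⟦_⟧ : Bool → ℕ
⟦ b ⟧ = if b then 1 else 0

⟦⟧-∧ : ∀ b c → ⟦ b ∧ c ⟧ ≡ ⟦ b ⟧ * ⟦ c ⟧
⟦⟧-∧ true  c = sym (+-identityʳ ⟦ c ⟧)
⟦⟧-∧ false c = refl

if-then-0 : ∀ b n → (if b then n else 0) ≡ ⟦ b ⟧ * n
if-then-0 true  n = sym (+-identityʳ n)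
if-then-0 false n = refl

sum-splitAt : ∀ m {n} (f : Fin m ⊎ Fin n → ℕ) →
              sum (f ∘ splitAt m) ≡ sum (f ∘ inj₁) + sum (f ∘ inj₂)
sum-splitAt zero    f = refl
sum-splitAt (suc m) f = trans
  (cong (f (inj₁ zero) +_) (sum-splitAt m (f ∘ map₁ suc)))
  (sym (+-assoc (f (inj₁ zero)) _ _))

-- Chains: vertices, adjacency and degrees

-- Gluing two chains joins every exit of the first to every entry of the second.
-- In Chain l p q r there are p entries, each expecting l neighbours further left,
-- and q exits, each expecting r neighbours further right.  The successors in the
-- constructors force every inner cut to have an exit, for the sake of connectedness.

infixr 5 _⨾_

data Chain : (l p q r : ℕ) → Set where
  layer : ∀ l s r → Chain l s s r
  _⨾_   : ∀ {l p q r s t} → Chain l p (suc q) r → Chain (suc q) r s t → Chain l p s t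
  cone  : ∀ {l p q r} → Chain l p (suc q) r → Chain l p (suc q) r

private
  variable
    l p q r s t : ℕ

order : Chain l p q r → ℕ
order (layer l s r) = s
order (G ⨾ H)       = order G + order H
order (cone G)      = suc (order G)

-- Vertices mirror the shape of the chain, so that adjacency and degrees are defined by recursion on
-- it; `enumeration` then transports them to `Fin`.
Vertex : Chain l p q r → Set
Vertex (layer l s r) = Fin s
Vertex (G ⨾ H)       = Vertex G ⊎ Vertex H
Vertex (cone G)      = Fin 1 ⊎ Vertex G

enumeration : (G : Chain l p q r) → Fin (order G) ↔ Vertex G
enumeration (layer l s r) = ↔-id (Fin s)
enumeration (G ⨾ H)       = (enumeration G ⊎-↔ enumeration H) ↔-∘ +↔⊎
enumeration (cone G)      = (↔-id (Fin 1) ⊎-↔ enumeration G) ↔-∘ +↔⊎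

vertex : (G : Chain l p q r) → Fin (order G) → Vertex G
vertex G = Inverse.to (enumeration G)

index : (G : Chain l p q r) → Vertex G → Fin (order G)
index G = Inverse.from (enumeration G)

vertex-index : (G : Chain l p q r) → ∀ v → vertex G (index G v) ≡ v
vertex-index G v = Inverse.inverseˡ (enumeration G) refl

index-vertex : (G : Chain l p q r) → ∀ v → index G (vertex G v) ≡ v
index-vertex G v = Inverse.inverseʳ (enumeration G) refl

entry : (G : Chain l p q r) → Vertex G → Bool
entry (layer l s r) _        = true
entry (G ⨾ H)       (inj₁ v) = entry G v
entry (G ⨾ H)       (inj₂ v) = false
entry (cone G)      (inj₁ _) = false
entry (cone G)      (inj₂ v) = entry G v

exit : (G : Chain l p q r) → Vertex G → Bool
exit (layer l s r) _        = true
exit (G ⨾ H)       (inj₁ v) = false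
exit (G ⨾ H)       (inj₂ v) = exit H v
exit (cone G)      (inj₁ _) = false
exit (cone G)      (inj₂ v) = exit G v

adj : (G : Chain l p q r) → Vertex G → Vertex G → Bool
adj (layer l s r) _        _        = false
adj (G ⨾ H)       (inj₁ u) (inj₁ v) = adj G u v
adj (G ⨾ H)       (inj₁ u) (inj₂ v) = exit G u ∧ entry H v
adj (G ⨾ H)       (inj₂ u) (inj₁ v) = exit G v ∧ entry H u
adj (G ⨾ H)       (inj₂ u) (inj₂ v) = adj H u v
adj (cone G)      (inj₁ _) (inj₁ _) = false
adj (cone G)      (inj₁ _) (inj₂ _) = true
adj (cone G)      (inj₂ _) (inj₁ _) = true
adj (cone G)      (inj₂ u) (inj₂ v) = adj G u v

-- The degree once the expected outer neighbours are present.
deg : (G : Chain l p q r) → Vertex G → ℕ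
deg (layer l s r) _        = l + r
deg (G ⨾ H)       (inj₁ v) = deg G v
deg (G ⨾ H)       (inj₂ v) = deg H v
deg (cone G)      (inj₁ _) = order G
deg (cone G)      (inj₂ v) = suc (deg G v)

adj-sym : (G : Chain l p q r) → ∀ u v → adj G u v ≡ adj G v u
adj-sym (layer l s r) u        v        = refl
adj-sym (G ⨾ H)       (inj₁ u) (inj₁ v) = adj-sym G u v
adj-sym (G ⨾ H)       (inj₁ u) (inj₂ v) = refl
adj-sym (G ⨾ H)       (inj₂ u) (inj₁ v) = refl
adj-sym (G ⨾ H)       (inj₂ u) (inj₂ v) = adj-sym H u v
adj-sym (cone G)      (inj₁ _) (inj₁ _) = refl
adj-sym (cone G)      (inj₁ _) (inj₂ _) = refl
adj-sym (cone G)      (inj₂ _) (inj₁ _) = refl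
adj-sym (cone G)      (inj₂ u) (inj₂ v) = adj-sym G u v

adj-irrefl : (G : Chain l p q r) → ∀ v → adj G v v ≡ false
adj-irrefl (layer l s r) v        = refl
adj-irrefl (G ⨾ H)       (inj₁ v) = adj-irrefl G v
adj-irrefl (G ⨾ H)       (inj₂ v) = adj-irrefl H v
adj-irrefl (cone G)      (inj₁ _) = refl
adj-irrefl (cone G)      (inj₂ v) = adj-irrefl G v

-- Sums over the vertices of a chain

total : (G : Chain l p q r) → (Vertex G → ℕ) → ℕ
total G f = ∑[ i < order G ] f (vertex G i)


total-⨾ : (G : Chain l p (suc q) r) (H : Chain (suc q) r s t) (f : Vertex (G ⨾ H) → ℕ) →
          total (G ⨾ H) f ≡ total G (f ∘ inj₁) + total H (f ∘ inj₂)
total-⨾ G H f = sum-splitAt (order G) (f ∘ map (vertex G) (vertex H))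

module _ (G : Chain l p q r) where

  total-cong : {f g : Vertex G → ℕ} → (∀ v → f v ≡ g v) → total G f ≡ total G g
  total-cong f≗g = sum-cong-≗ (f≗g ∘ vertex G)

  total-+ : (f g : Vertex G → ℕ) → total G (λ v → f v + g v) ≡ total G f + total G g
  total-+ f g = ∑-distrib-+ (f ∘ vertex G) (g ∘ vertex G)

  total-*ˡ : ∀ c (f : Vertex G → ℕ) → total G (λ v → c * f v) ≡ c * total G f
  total-*ˡ c f = sym (*-distribˡ-sum c (f ∘ vertex G))

  total-*ʳ : ∀ c (f : Vertex G → ℕ) → total G (λ v → f v * c) ≡ total G f * c
  total-*ʳ c f = sym (*-distribʳ-sum c (f ∘ vertex G))

  total-0 : total G (λ _ → 0) ≡ 0
  total-0 = sum-replicate-zero (order G)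

  total-const : ∀ c → total G (λ _ → c) ≡ order G * c
  total-const c = go (order G)
    where
    go : ∀ n → ∑[ i < n ] c ≡ n * c
    go zero    = refl
    go (suc n) = cong (c +_) (go n)

-- The edges across a gluing form a complete bipartite graph between exits and entries, so a sum of
-- product weights over them factorises.
total-∧ : (G : Chain l p q r) {l′ p′ q′ r′ : ℕ} (H : Chain l′ p′ q′ r′)
          (b : Vertex G → Bool) (c : Vertex H → Bool) (f : Vertex G → ℕ) (g : Vertex H → ℕ) →
          total G (λ v → total H λ u → ⟦ b v ∧ c u ⟧ * (f v * g u)) ≡
          total G (λ v → ⟦ b v ⟧ * f v) * total H (λ u → ⟦ c u ⟧ * g u)
total-∧ G H b c f g = begin
  total G (λ v → total H λ u → ⟦ b v ∧ c u ⟧ * (f v * g u))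
    ≡⟨ total-cong G (λ v → total-cong H λ u →
         trans (cong (_* (f v * g u)) (⟦⟧-∧ (b v) (c u))) (interchange ⟦ b v ⟧ ⟦ c u ⟧ (f v) (g u))) ⟩
  total G (λ v → total H λ u → ⟦ b v ⟧ * f v * (⟦ c u ⟧ * g u))
    ≡⟨ total-cong G (λ v → total-*ˡ H (⟦ b v ⟧ * f v) (λ u → ⟦ c u ⟧ * g u)) ⟩
  total G (λ v → ⟦ b v ⟧ * f v * total H (λ u → ⟦ c u ⟧ * g u))
    ≡⟨ total-*ʳ G _ (λ v → ⟦ b v ⟧ * f v) ⟩
  total G (λ v → ⟦ b v ⟧ * f v) * total H (λ u → ⟦ c u ⟧ * g u) ∎
  where
  interchange : ∀ w x y z → w * x * (y * z) ≡ w * y * (x * z)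
  interchange = solve-∀

-- Counting entries, exits and neighbours

entry-count : (G : Chain l p q r) → total G (⟦_⟧ ∘ entry G) ≡ p
entry-count (layer l s r) = trans (total-const (layer l s r) 1) (*-identityʳ s)
entry-count (G ⨾ H)       = begin
  total (G ⨾ H) (⟦_⟧ ∘ entry (G ⨾ H))           ≡⟨ total-⨾ G H (⟦_⟧ ∘ entry (G ⨾ H)) ⟩
  total G (⟦_⟧ ∘ entry G) + total H (λ _ → 0)   ≡⟨ cong₂ _+_ (entry-count G) (total-0 H) ⟩
  _ + 0                                         ≡⟨ +-identityʳ _ ⟩
  _                                             ∎
entry-count (cone G)      = entry-count G

exit-count : (G : Chain l p q r) → total G (⟦_⟧ ∘ exit G) ≡ q
exit-count (layer l s r) = trans (total-const (layer l s r) 1) (*-identityʳ s)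
exit-count (G ⨾ H)       = trans (total-⨾ G H (⟦_⟧ ∘ exit (G ⨾ H))) (cong₂ _+_ (total-0 G) (exit-count H))
exit-count (cone G)      = exit-count G

private
  total-∧ˡ : ∀ b (G : Chain l p q r) (c : Vertex G → Bool) →
             total G (λ u → ⟦ b ∧ c u ⟧) ≡ ⟦ b ⟧ * total G (⟦_⟧ ∘ c)
  total-∧ˡ b G c = trans (total-cong G (λ u → ⟦⟧-∧ b (c u))) (total-*ˡ G ⟦ b ⟧ (⟦_⟧ ∘ c))

  total-∧ʳ : ∀ b (G : Chain l p q r) (c : Vertex G → Bool) →
             total G (λ u → ⟦ c u ∧ b ⟧) ≡ total G (⟦_⟧ ∘ c) * ⟦ b ⟧
  total-∧ʳ b G c = trans (total-cong G (λ u → ⟦⟧-∧ (c u) b)) (total-*ʳ G ⟦ b ⟧ (⟦_⟧ ∘ c))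

neighbours : (G : Chain l p q r) → Vertex G → ℕ
neighbours G v = total G (λ u → ⟦ adj G v u ⟧)

-- The index shared by the two parts of a gluing makes this work: an exit of `G` lacks `r`
-- neighbours on its right, and the `r` entries of `H` supply exactly these; symmetrically for the
-- entries of `H`. When `l` and `r` are 0 the correction vanishes and `deg` is the true degree.
deg-correct : (G : Chain l p q r) → ∀ v →
              neighbours G v + (l * ⟦ entry G v ⟧ + r * ⟦ exit G v ⟧) ≡ deg G v
deg-correct (layer l s r) v =
  cong₂ _+_ (total-0 (layer l s r)) (cong₂ _+_ (*-identityʳ l) (*-identityʳ r))
deg-correct {l} {q = q} {r = t} (_⨾_ {q = q′} {r = r} G H) (inj₁ v) = begin
  neighbours (G ⨾ H) (inj₁ v) + (l * ⟦ entry G v ⟧ + t * 0)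
    ≡⟨ cong (_+ (l * ⟦ entry G v ⟧ + t * 0)) (total-⨾ G H (⟦_⟧ ∘ adj (G ⨾ H) (inj₁ v))) ⟩
  neighbours G v + total H (λ u → ⟦ exit G v ∧ entry H u ⟧) + (l * ⟦ entry G v ⟧ + t * 0)
    ≡⟨ cong (λ z → neighbours G v + z + (l * ⟦ entry G v ⟧ + t * 0))
         (trans (total-∧ˡ (exit G v) H (entry H)) (cong (⟦ exit G v ⟧ *_) (entry-count H))) ⟩
  neighbours G v + ⟦ exit G v ⟧ * r + (l * ⟦ entry G v ⟧ + t * 0)
    ≡⟨ rearrange (neighbours G v) ⟦ exit G v ⟧ r (l * ⟦ entry G v ⟧) t ⟩
  neighbours G v + (l * ⟦ entry G v ⟧ + r * ⟦ exit G v ⟧)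
    ≡⟨ deg-correct G v ⟩
  deg G v ∎
  where
  rearrange : ∀ n e r x t → n + e * r + (x + t * 0) ≡ n + (x + r * e)
  rearrange = solve-∀
deg-correct {l} {q = q} {r = t} (_⨾_ {q = q′} {r = r} G H) (inj₂ v) = begin
  neighbours (G ⨾ H) (inj₂ v) + (l * 0 + t * ⟦ exit H v ⟧)
    ≡⟨ cong (_+ (l * 0 + t * ⟦ exit H v ⟧)) (total-⨾ G H (⟦_⟧ ∘ adj (G ⨾ H) (inj₂ v))) ⟩
  total G (λ u → ⟦ exit G u ∧ entry H v ⟧) + neighbours H v + (l * 0 + t * ⟦ exit H v ⟧)
    ≡⟨ cong (λ z → z + neighbours H v + (l * 0 + t * ⟦ exit H v ⟧))
         (trans (total-∧ʳ (entry H v) G (exit G)) (cong (_* ⟦ entry H v ⟧) (exit-count G))) ⟩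
  suc q′ * ⟦ entry H v ⟧ + neighbours H v + (l * 0 + t * ⟦ exit H v ⟧)
    ≡⟨ rearrange (suc q′ * ⟦ entry H v ⟧) (neighbours H v) l (t * ⟦ exit H v ⟧) ⟩
  neighbours H v + (suc q′ * ⟦ entry H v ⟧ + t * ⟦ exit H v ⟧)
    ≡⟨ deg-correct H v ⟩
  deg H v ∎
  where
  rearrange : ∀ e n l y → e + n + (l * 0 + y) ≡ n + (e + y)
  rearrange = solve-∀
deg-correct {l} {r = r} (cone G) (inj₁ zero) = begin
  total G (λ _ → 1) + (l * 0 + r * 0) ≡⟨ cong₂ _+_ (total-const G 1) (cong₂ _+_ (*-zeroʳ l) (*-zeroʳ r)) ⟩
  order G * 1 + 0                     ≡⟨ +-identityʳ _ ⟩
  order G * 1                         ≡⟨ *-identityʳ _ ⟩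
  order G                             ∎
deg-correct (cone G) (inj₂ v) = cong suc (deg-correct G v)

-- Connectedness

Adjacent : (G : Chain l p q r) → Vertex G → Vertex G → Set
Adjacent G u v = T (adj G u v)

Adjacent-sym : (G : Chain l p q r) → ∀ {u v} → Adjacent G u v → Adjacent G v u
Adjacent-sym G {u} {v} = subst T (adj-sym G u v)

exit-vertex : (G : Chain l p (suc q) r) → Σ[ v ∈ Vertex G ] T (exit G v)
exit-vertex (layer l s r) = zero , _
exit-vertex (G ⨾ H)       = let v , e = exit-vertex H in inj₂ v , e
exit-vertex (cone G)      = let v , e = exit-vertex G in inj₂ v , e

-- Paths lead leftwards: an entry of the right part of a gluing is adjacent to every exit of the
-- left part, and the left part has an exit.
reaches-entry : (G : Chain l p q r) → ∀ v → Σ[ u ∈ Vertex G ] (T (entry G u) × Star (Adjacent G) v u)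
reaches-entry (layer l s r) v        = v , _ , ε
reaches-entry (G ⨾ H)       (inj₁ v) =
  let u , e , path = reaches-entry G v in inj₁ u , e , gmap inj₁ id path
reaches-entry (G ⨾ H)       (inj₂ v) =
  let x , xe , H-path = reaches-entry H v
      y , ye          = exit-vertex G
      u , ue , G-path = reaches-entry G y
  in inj₁ u , ue , gmap inj₂ id H-path ◅◅ Equivalence.from T-∧ (ye , xe) ◅ gmap inj₁ id G-path
reaches-entry (cone G)      (inj₁ _) =
  -- Any vertex of `G` would do here, since all of them are adjacent to the hub.
  let y , _        = exit-vertex G
      u , ue , path = reaches-entry G y
  in inj₂ u , ue , _◅_ {j = inj₂ y} _ (gmap inj₂ id path)
reaches-entry (cone G)      (inj₂ v) =
  let u , e , path = reaches-entry G v in inj₂ u , e , gmap inj₂ id path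

entry-unique : (G : Chain l 1 q r) → ∀ u v → T (entry G u) → T (entry G v) → u ≡ v
entry-unique (layer l s r) zero     zero     _ _ = refl
entry-unique (G ⨾ H)       (inj₁ u) (inj₁ v) d e = cong inj₁ (entry-unique G u v d e)
entry-unique (cone G)      (inj₂ u) (inj₂ v) d e = cong inj₂ (entry-unique G u v d e)

-- With a single entry, the leftward paths from `u` and from `v` end at the same vertex.
path-between : (G : Chain l 1 q r) → ∀ u v → Star (Adjacent G) u v
path-between G u v =
  let x , xe , u⟶x = reaches-entry G u
      y , ye , v⟶y = reaches-entry G v
  in u⟶x ◅◅ subst (λ z → Star (Adjacent G) z v) (entry-unique G y x ye xe) (reverse (Adjacent-sym G) v⟶y)

-- Degree statistics

-- On a closed chain these are 2m, M₁ and 2 M₂, since `total-adj` runs over ordered pairs. As `deg`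
-- already includes the outer neighbours, gluing changes no degree; `total-entry` and `total-exit`
-- record what the new edges contribute.
total-deg total-deg² total-adj total-entry total-exit : Chain l p q r → ℕ
total-deg   G = total G (deg G)
total-deg²  G = total G (λ v → deg G v ^ 2)
total-adj   G = total G (λ v → total G λ u → ⟦ adj G v u ⟧ * (deg G v * deg G u))
total-entry G = total G (λ v → ⟦ entry G v ⟧ * deg G v)
total-exit  G = total G (λ v → ⟦ exit G v ⟧ * deg G v)

record Stats (G : Chain l p q r) (n σ₁ σ₂ μ a b : ℕ) : Set where
  constructor stats
  field
    order≡       : order G ≡ n
    total-deg≡   : total-deg G ≡ σ₁
    total-deg²≡  : total-deg² G ≡ σ₂
    total-adj≡   : total-adj G ≡ μ
    total-entry≡ : total-entry G ≡ a
    total-exit≡  : total-exit G ≡ b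

-- The last summand comes from the edges between exits of `G` and entries of `H`, each counted in
-- both orders.
total-adj-⨾ : (G : Chain l p (suc q) r) (H : Chain (suc q) r s t) →
              total-adj (G ⨾ H) ≡ total-adj G + total-adj H + 2 * (total-exit G * total-entry H)
total-adj-⨾ G H = begin
  total-adj (G ⨾ H)
    ≡⟨ total-⨾ G H (λ v → total (G ⨾ H) (term v)) ⟩
  total G (λ v → total (G ⨾ H) (term (inj₁ v))) + total H (λ v → total (G ⨾ H) (term (inj₂ v)))
    ≡⟨ cong₂ _+_ (total-cong G (λ v → total-⨾ G H (term (inj₁ v))))
                 (total-cong H (λ v → total-⨾ G H (term (inj₂ v)))) ⟩
  total G (λ v → total G (term (inj₁ v) ∘ inj₁) + total H (term (inj₁ v) ∘ inj₂)) +
  total H (λ v → total G (term (inj₂ v) ∘ inj₁) + total H (term (inj₂ v) ∘ inj₂))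
    ≡⟨ cong₂ _+_ (total-+ G (λ v → total G (term (inj₁ v) ∘ inj₁)) (λ v → total H (term (inj₁ v) ∘ inj₂)))
                 (total-+ H (λ v → total G (term (inj₂ v) ∘ inj₁)) (λ v → total H (term (inj₂ v) ∘ inj₂))) ⟩
  total-adj G + total G (λ v → total H (term (inj₁ v) ∘ inj₂)) +
  (total H (λ v → total G (term (inj₂ v) ∘ inj₁)) + total-adj H)
    ≡⟨ cong₂ (λ y z → total-adj G + y + (z + total-adj H)) cross cross′ ⟩
  total-adj G + total-exit G * total-entry H + (total-entry H * total-exit G + total-adj H)
    ≡⟨ rearrange (total-adj G) (total-adj H) (total-exit G) (total-entry H) ⟩
  total-adj G + total-adj H + 2 * (total-exit G * total-entry H) ∎
  where
  term : Vertex (G ⨾ H) → Vertex (G ⨾ H) → ℕ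
  term v u = ⟦ adj (G ⨾ H) v u ⟧ * (deg (G ⨾ H) v * deg (G ⨾ H) u)
  cross : total G (λ v → total H (term (inj₁ v) ∘ inj₂)) ≡ total-exit G * total-entry H
  cross = total-∧ G H (exit G) (entry H) (deg G) (deg H)
  cross′ : total H (λ v → total G (term (inj₂ v) ∘ inj₁)) ≡ total-entry H * total-exit G
  cross′ = trans
    (total-cong H λ v → total-cong G λ u →
      cong (λ b → ⟦ b ⟧ * (deg H v * deg G u)) (∧-comm (exit G u) (entry H v)))
    (total-∧ H G (entry H) (exit G) (deg H) (deg G))
  rearrange : ∀ g h b a → g + b * a + (a * b + h) ≡ g + h + 2 * (b * a)
  rearrange = solve-∀

⨾-stats : {G : Chain l p (suc q) r} {H : Chain (suc q) r s t} {n σ₁ σ₂ μ a b n′ σ₁′ σ₂′ μ′ a′ b′ : ℕ} →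
          Stats G n σ₁ σ₂ μ a b → Stats H n′ σ₁′ σ₂′ μ′ a′ b′ →
          Stats (G ⨾ H) (n + n′) (σ₁ + σ₁′) (σ₂ + σ₂′) (μ + μ′ + 2 * (b * a′)) a b′
⨾-stats {G = G} {H} (stats refl refl refl refl refl refl) (stats refl refl refl refl refl refl) = record
  { order≡       = refl
  ; total-deg≡   = total-⨾ G H (deg (G ⨾ H))
  ; total-deg²≡  = total-⨾ G H (λ v → deg (G ⨾ H) v ^ 2)
  ; total-adj≡   = total-adj-⨾ G H
  ; total-entry≡ = trans (total-⨾ G H (λ v → ⟦ entry (G ⨾ H) v ⟧ * deg (G ⨾ H) v))
                     (trans (cong (total-entry G +_) (total-0 H)) (+-identityʳ _))
  ; total-exit≡  = trans (total-⨾ G H (λ v → ⟦ exit (G ⨾ H) v ⟧ * deg (G ⨾ H) v))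
                     (cong (_+ total-exit H) (total-0 G))
  }

-- iterate k G consists of k + 1 copies of G.
iterate : ℕ → Chain (suc q) r (suc q) r → Chain (suc q) r (suc q) r
iterate zero    G = G
iterate (suc k) G = G ⨾ iterate k G

-- Between `suc k` copies there are `k` junctions, each adding `2 * (b * a)` to `total-adj`.
iterate-stats : ∀ k {G : Chain (suc q) r (suc q) r} {n σ₁ σ₂ μ a b : ℕ} → Stats G n σ₁ σ₂ μ a b →
                Stats (iterate k G) (suc k * n) (suc k * σ₁) (suc k * σ₂) (suc k * μ + k * (2 * (b * a))) a b
iterate-stats zero {G} {n} {σ₁} {σ₂} {μ} G-stats = record
  { order≡       = trans order≡ (sym (*-identityˡ n))
  ; total-deg≡   = trans total-deg≡ (sym (*-identityˡ σ₁))
  ; total-deg²≡  = trans total-deg²≡ (sym (*-identityˡ σ₂))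
  ; total-adj≡   = trans total-adj≡ (sym (trans (+-identityʳ _) (*-identityˡ μ)))
  ; total-entry≡ = total-entry≡
  ; total-exit≡  = total-exit≡
  }
  where open Stats G-stats
iterate-stats (suc k) {G} {μ = μ} {a} {b} G-stats =
  -- The other five statistics agree definitionally.
  record { S hiding (total-adj≡); total-adj≡ = trans S.total-adj≡ (rearrange k μ (2 * (b * a))) }
  where
  module S = Stats (⨾-stats G-stats (iterate-stats k G-stats))
  rearrange : ∀ k μ c → μ + (suc k * μ + k * c) + c ≡ suc (suc k) * μ + suc k * c
  rearrange = solve-∀

iterate-deg : (P : ℕ → Set) → ∀ k {G : Chain (suc q) r (suc q) r} →
              (∀ v → P (deg G v)) → ∀ v → P (deg (iterate k G) v)
iterate-deg P zero    h v        = h v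
iterate-deg P (suc k) h (inj₁ v) = h v
iterate-deg P (suc k) h (inj₂ v) = iterate-deg P k h v

-- Handshake count, and cones over chains of constant degree

total-neighbours : (G : Chain l p q r) → total G (neighbours G) + (l * p + r * q) ≡ total-deg G
total-neighbours {l} {p} {q} {r} G = sym (begin
  total G (deg G)
    ≡⟨ total-cong G (deg-correct G) ⟨
  total G (λ v → neighbours G v + (l * ⟦ entry G v ⟧ + r * ⟦ exit G v ⟧))
    ≡⟨ total-+ G (neighbours G) (λ v → l * ⟦ entry G v ⟧ + r * ⟦ exit G v ⟧) ⟩
  total G (neighbours G) + total G (λ v → l * ⟦ entry G v ⟧ + r * ⟦ exit G v ⟧)
    ≡⟨ cong (total G (neighbours G) +_) (total-+ G (λ v → l * ⟦ entry G v ⟧) (λ v → r * ⟦ exit G v ⟧)) ⟩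
  total G (neighbours G) + (total G (λ v → l * ⟦ entry G v ⟧) + total G (λ v → r * ⟦ exit G v ⟧))
    ≡⟨ cong (total G (neighbours G) +_) (cong₂ _+_
         (trans (total-*ˡ G l (⟦_⟧ ∘ entry G)) (cong (l *_) (entry-count G)))
         (trans (total-*ˡ G r (⟦_⟧ ∘ exit G)) (cong (r *_) (exit-count G)))) ⟩
  total G (neighbours G) + (l * p + r * q) ∎)

module _ (G : Chain l p (suc q) r) {d : ℕ} (deg≡d : ∀ v → deg G v ≡ d) where

  private
    n = order G

    weighted : (b : Vertex G → Bool) → total G (λ v → ⟦ b v ⟧ * suc (deg G v)) ≡ total G (⟦_⟧ ∘ b) * suc d
    weighted b = trans
      (total-cong G (λ v → cong (λ e → ⟦ b v ⟧ * suc e) (deg≡d v)))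
      (total-*ʳ G (suc d) (⟦_⟧ ∘ b))

  cone-total-deg : total-deg (cone G) ≡ n + n * suc d
  cone-total-deg = cong (n +_) (trans (total-cong G (cong suc ∘ deg≡d)) (total-const G (suc d)))

  cone-total-deg² : total-deg² (cone G) ≡ n ^ 2 + n * suc d ^ 2
  cone-total-deg² = cong (n ^ 2 +_)
    (trans (total-cong G (cong (λ e → suc e ^ 2) ∘ deg≡d)) (total-const G (suc d ^ 2)))

  cone-total-entry : total-entry (cone G) ≡ p * suc d
  cone-total-entry = trans (weighted (entry G)) (cong (_* suc d) (entry-count G))

  cone-total-exit : total-exit (cone G) ≡ suc q * suc d
  cone-total-exit = trans (weighted (exit G)) (cong (_* suc d) (exit-count G))

  -- The hub has `n` edges of weight `n * suc d`, and every rim edge has weight `suc d * suc d`. By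
  -- `total-neighbours` the rim edges, counted in both orders, number `n * d` minus the
  -- `l * p + r * suc q` that lead out of the chain; the latter stand on the left to avoid
  -- subtraction.
  cone-total-adj : total-adj (cone G) + (l * p + r * suc q) * (suc d * suc d) ≡
                   2 * (n * (n * suc d)) + n * d * (suc d * suc d)
  cone-total-adj = begin
    total-adj (cone G) + c * e
      ≡⟨ cong (_+ c * e) (cong₂ _+_ hub-row (trans (total-cong G rim-row) rim-rows)) ⟩
    n * (1 * (n * suc d)) + (n * (1 * (suc d * n)) + total G (neighbours G) * e) + c * e
      ≡⟨ rearrange n d (total G (neighbours G)) c e ⟩
    2 * (n * (n * suc d)) + (total G (neighbours G) + c) * e
      ≡⟨ cong (λ z → 2 * (n * (n * suc d)) + z * e) (begin
           total G (neighbours G) + c  ≡⟨ total-neighbours G ⟩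
           total G (deg G)             ≡⟨ total-cong G deg≡d ⟩
           total G (λ _ → d)           ≡⟨ total-const G d ⟩
           n * d                       ∎) ⟩
    2 * (n * (n * suc d)) + n * d * e ∎
    where
    c = l * p + r * suc q
    e = suc d * suc d
    hub-row : total G (λ u → 1 * (n * suc (deg G u))) ≡ n * (1 * (n * suc d))
    hub-row = trans (total-cong G (λ u → cong (λ e → 1 * (n * suc e)) (deg≡d u))) (total-const G _)
    rim-row : ∀ v → 1 * (suc (deg G v) * n) + total G (λ u → ⟦ adj G v u ⟧ * (suc (deg G v) * suc (deg G u))) ≡
                    1 * (suc d * n) + neighbours G v * e
    rim-row v = cong₂ _+_ (cong (λ e → 1 * (suc e * n)) (deg≡d v)) (trans
      (total-cong G (λ u → cong₂ (λ x y → ⟦ adj G v u ⟧ * (suc x * suc y)) (deg≡d v) (deg≡d u)))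
      (total-*ʳ G e (λ u → ⟦ adj G v u ⟧)))
    rim-rows : total G (λ v → 1 * (suc d * n) + neighbours G v * e) ≡
               n * (1 * (suc d * n)) + total G (neighbours G) * e
    rim-rows = trans (total-+ G (λ _ → 1 * (suc d * n)) (λ v → neighbours G v * e))
      (cong₂ _+_ (total-const G (1 * (suc d * n))) (total-*ʳ G e (neighbours G)))
    rearrange : ∀ n d s c e → n * (1 * (n * suc d)) + (n * (1 * (suc d * n)) + s * e) + c * e ≡
                              2 * (n * (n * suc d)) + (s + c) * e
    rearrange = solve-∀

-- Lenses, fans and caterpillars

point : Chain 1 1 1 1
point = layer 1 1 1

-- The rim is a path on `suc k` vertices, so the hub has degree `suc k`; with the outer neighbours
-- of its ends, every rim vertex has degree 3. For `k = 2` this is the diamond, K₄ minus an edge.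
fan : ℕ → Chain 1 1 1 1
fan k = cone (iterate k point)

-- Two vertices of degree 5 joined through four vertices of degree 2. The leading `point` makes the
-- link between consecutive lenses an edge of type (5,2) as well.
lens : Chain 1 1 1 1
lens = point ⨾ layer 1 1 4 ⨾ layer 1 4 1 ⨾ layer 4 1 1

point-stats : Stats point 1 2 4 0 2 2
point-stats = stats refl refl refl refl refl refl

lens-stats : Stats lens 7 20 70 180 2 5
lens-stats = stats refl refl refl refl refl refl

order-path : ∀ k → order (iterate k point) ≡ suc k
order-path k = trans (Stats.order≡ (iterate-stats k point-stats)) (*-identityʳ (suc k))

fan-stats : ∀ k → Stats (fan k) (2 + k) (4 * (1 + k)) ((1 + k) * (10 + k)) (6 * ((1 + k) * (1 + k)) + 18 * k) 3 3
fan-stats k = record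
  { order≡       = cong suc n≡
  ; total-deg≡   = trans (cone-total-deg path deg≡2) (trans (cong (λ n → n + n * 3) n≡) (arith₁ k))
  ; total-deg²≡  = trans (cone-total-deg² path deg≡2) (trans (cong (λ n → n ^ 2 + n * 9) n≡) (arith₂ k))
  -- 18 = (1 + 1) * (3 * 3): one edge leads out at each end of the rim.
  ; total-adj≡   = +-cancelʳ-≡ 18 _ _ (trans (cone-total-adj path deg≡2)
                     (trans (cong (λ n → 2 * (n * (n * 3)) + n * 2 * 9) n≡) (arith₃ k)))
  ; total-entry≡ = cone-total-entry path deg≡2
  ; total-exit≡  = cone-total-exit path deg≡2
  }
  where
  path = iterate k point
  n≡ = order-path k
  deg≡2 : ∀ v → deg path v ≡ 2
  deg≡2 = iterate-deg (_≡ 2) k (λ _ → refl)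
  arith₁ : ∀ k → suc k + suc k * 3 ≡ 4 * (1 + k)
  arith₁ = solve-∀
  arith₂ : ∀ k → suc k * (suc k * 1) + suc k * 9 ≡ (1 + k) * (10 + k)
  arith₂ = solve-∀
  arith₃ : ∀ k → 2 * (suc k * (suc k * 3)) + suc k * 2 * 9 ≡ 6 * ((1 + k) * (1 + k)) + 18 * k + 18
  arith₃ = solve-∀

-- The numbers of lenses, fans and diamonds are `suc x`, `suc f` and `suc y`.
caterpillar : (k x f y : ℕ) → Chain 0 1 1 0
caterpillar k x f y =
  layer 0 1 1 ⨾ iterate x lens ⨾ iterate f (fan k) ⨾ iterate y (fan 2) ⨾ point ⨾ layer 1 1 0

-- In `total-adj` each block absorbs one junction: 200 = 180 + 20 for a lens, 108 = 90 + 18 for a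
-- diamond. The constant 12 is what remains: 4 + 30 + 12 + 4 from the other junctions, minus 20 and
-- 18 for the absorbed junctions that are absent.
caterpillar-stats : ∀ k x f y → Stats (caterpillar k x f y)
  (7 * suc x + suc f * (2 + k) + 4 * suc y + 3)
  (20 * suc x + suc f * (4 * (1 + k)) + 12 * suc y + 4)
  (70 * suc x + suc f * ((1 + k) * (10 + k)) + 36 * suc y + 6)
  (200 * suc x + suc f * (6 * ((1 + k) * (4 + k))) + 108 * suc y + 12)
  1 1
caterpillar-stats k x f y = record
  { order≡       = trans S.order≡ (arith₀ k x f y)
  ; total-deg≡   = trans S.total-deg≡ (arith₁ k x f y)
  ; total-deg²≡  = trans S.total-deg²≡ (arith₂ k x f y)
  ; total-adj≡   = trans S.total-adj≡ (arith₃ k x f y)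
  ; total-entry≡ = S.total-entry≡
  ; total-exit≡  = S.total-exit≡
  }
  where
  leafˡ : Stats (layer 0 1 1) 1 1 1 0 1 1
  leafˡ = stats refl refl refl refl refl refl
  leafʳ : Stats (layer 1 1 0) 1 1 1 0 1 1
  leafʳ = stats refl refl refl refl refl refl
  module S = Stats
    (⨾-stats leafˡ (⨾-stats (iterate-stats x lens-stats) (⨾-stats (iterate-stats f (fan-stats k))
      (⨾-stats (iterate-stats y (fan-stats 2)) (⨾-stats point-stats leafʳ)))))
  arith₀ : ∀ k x f y → 1 + (suc x * 7 + (suc f * (2 + k) + (suc y * 4 + 2))) ≡
           7 * suc x + suc f * (2 + k) + 4 * suc y + 3
  arith₀ = solve-∀
  arith₁ : ∀ k x f y → 1 + (suc x * 20 + (suc f * (4 * (1 + k)) + (suc y * 12 + 3))) ≡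
           20 * suc x + suc f * (4 * (1 + k)) + 12 * suc y + 4
  arith₁ = solve-∀
  arith₂ : ∀ k x f y → 1 + (suc x * 70 + (suc f * ((1 + k) * (10 + k)) + (suc y * 36 + 5))) ≡
           70 * suc x + suc f * ((1 + k) * (10 + k)) + 36 * suc y + 6
  arith₂ = solve-∀
  arith₃ : ∀ k x f y →
           (suc x * 180 + x * 20 +
             (suc f * (6 * ((1 + k) * (1 + k)) + 18 * k) + f * 18 + (suc y * 90 + y * 18 + 4 + 12) + 18) + 30) + 4 ≡
           200 * suc x + suc f * (6 * ((1 + k) * (4 + k))) + 108 * suc y + 12
  arith₃ = solve-∀

-- Chains as graphs

-- Used with `A`, `B` the two strict orders of a pair of vertices and `C`, `D` its adjacency read
-- both ways: an adjacent pair is counted in exactly one of its orders.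
if-×-dec : ∀ {A B C D : Set} (a : Dec A) (b : Dec B) (c : Dec C) (d : Dec D) →
           (A → ¬ B) → (C → D) → (D → C) → (C → A ⊎ B) → ∀ {m n : ℕ} → m ≡ n →
           (if does (a ×-dec c) then m else 0) + (if does (b ×-dec d) then n else 0) ≡
           (if does c then m else 0)
if-×-dec (yes a) (yes b) _       _       ¬ab _   _   _  _    = ⊥-elim (¬ab a b)
if-×-dec (yes _) (no _)  (yes _) _       _   _   _   _  _    = +-identityʳ _
if-×-dec (yes _) (no _)  (no _)  _       _   _   _   _  _    = refl
if-×-dec (no _)  (yes _) (yes _) (yes _) _   _   _   _  refl = refl
if-×-dec (no _)  (yes _) (yes c) (no ¬d) _   c→d _   _  _    = ⊥-elim (¬d (c→d c))
if-×-dec (no _)  (yes _) (no ¬c) (yes d) _   _   d→c _  _    = ⊥-elim (¬c (d→c d))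
if-×-dec (no _)  (yes _) (no _)  (no _)  _   _   _   _  _    = refl
if-×-dec (no _)  (no _)  (no _)  _       _   _   _   _  _    = refl
if-×-dec (no ¬a) (no ¬b) (yes c) _       _   _   _   ab _    with ab c
... | inj₁ a = ⊥-elim (¬a a)
... | inj₂ b = ⊥-elim (¬b b)

-- Exchanging the summations in one copy makes it run over the pairs with `v < u`; the two copies
-- together then cover each ordered adjacent pair once.
sumOverEdges-double : (G : Graph) (f : Graph.Vertex G → Graph.Vertex G → ℕ) → (∀ u v → f u v ≡ f v u) →
                      Graph.sumOverEdges G f + Graph.sumOverEdges G f ≡
                      ∑[ u < Graph.order G ] ∑[ v < Graph.order G ] (if does (Graph._~?_ G u v) then f u v else 0)
sumOverEdges-double G f f-sym = begin
  ∑[ u < n ] ∑[ v < n ] up u v + ∑[ u < n ] ∑[ v < n ] up u v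
    ≡⟨ cong (∑[ u < n ] ∑[ v < n ] up u v +_) (∑-comm up) ⟩
  ∑[ u < n ] ∑[ v < n ] up u v + ∑[ u < n ] ∑[ v < n ] up v u
    ≡⟨ ∑-distrib-+ (λ u → ∑[ v < n ] up u v) (λ u → ∑[ v < n ] up v u) ⟨
  ∑[ u < n ] (∑[ v < n ] up u v + ∑[ v < n ] up v u)
    ≡⟨ sum-cong-≗ (λ u → trans (sym (∑-distrib-+ (up u) (λ v → up v u))) (sum-cong-≗ (split u))) ⟩
  ∑[ u < n ] ∑[ v < n ] (if does (u ~? v) then f u v else 0) ∎
  where
  open Graph G renaming (order to n) hiding (Vertex)
  up : Fin n → Fin n → ℕ
  up u v = if does ((u <? v) ×-dec (u ~? v)) then f u v else 0
  split : ∀ u v → up u v + up v u ≡ (if does (u ~? v) then f u v else 0)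
  split u v = if-×-dec (u <? v) (v <? u) (u ~? v) (v ~? u) <-asym ~-sym ~-sym ordered (f-sym u v)
    where
    ordered : u ~ v → u Fin.< v ⊎ v Fin.< u
    ordered u~v with Fin.<-cmp u v
    ... | tri< u<v _ _ = inj₁ u<v
    ... | tri≈ _ u≡v _ = ⊥-elim (~-irrefl u≡v u~v)
    ... | tri> _ _ v<u = inj₂ v<u

-- The quotient `_/_` is normalised, so the cross-multiplied equation is read as equality of
-- unnormalised rationals and carried over by `fromℚᵘ-cong`.
/-cong-* : ∀ a b c d .{{_ : NonZero b}} .{{_ : NonZero d}} → a * d ≡ c * b → (ℤ.+ a) / b ≡ (ℤ.+ c) / d
/-cong-* a (suc b) c (suc d) eq = fromℚᵘ-cong {mkℚᵘ (ℤ.+ a) b} {mkℚᵘ (ℤ.+ c) d}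
  (*≡* (trans (sym (ℤ.pos-* a (suc d))) (trans (cong ℤ.+_ eq) (ℤ.pos-* c (suc b)))))

graph : Chain l p q r → Graph
graph G = record
  { order    = order G
  ; _~_      = λ u v → Adjacent G (vertex G u) (vertex G v)
  ; _~?_     = λ u v → T? (adj G (vertex G u) (vertex G v))
  ; ~-sym    = Adjacent-sym G
  ; ~-irrefl = λ { {u} refl → subst T (adj-irrefl G (vertex G u)) }
  }

graph-connected : (G : Chain l 1 q r) → Graph.Connected (graph G)
graph-connected G u v = subst₂ (Star (Graph._~_ (graph G))) (index-vertex G u) (index-vertex G v)
  (gmap (index G) (subst₂ (Adjacent G) (sym (vertex-index G _)) (sym (vertex-index G _)))
    (path-between G (vertex G u) (vertex G v)))

module _ (G : Chain 0 p q 0) where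

  private
    Γ = graph G

  degree≡ : ∀ v → Graph.degree Γ v ≡ deg G (vertex G v)
  degree≡ v = trans (sym (+-identityʳ _)) (deg-correct G (vertex G v))

  degree-index : ∀ v → Graph.degree Γ (index G v) ≡ deg G v
  degree-index v = trans (degree≡ (index G v)) (cong (deg G) (vertex-index G v))

  M₁≡ : Graph.M₁ Γ ≡ total-deg² G
  M₁≡ = sum-cong-≗ (λ v → cong (_^ 2) (degree≡ v))

  double-size : Graph.size Γ + Graph.size Γ ≡ total-deg G
  double-size = trans (sumOverEdges-double Γ (λ _ _ → 1) (λ _ _ → refl)) (sum-cong-≗ degree≡)

  double-M₂ : Graph.M₂ Γ + Graph.M₂ Γ ≡ total-adj G
  double-M₂ = trans
    (sumOverEdges-double Γ (λ u v → Graph.degree Γ u * Graph.degree Γ v)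
      (λ u v → *-comm (Graph.degree Γ u) (Graph.degree Γ v)))
    (sum-cong-≗ λ u → sum-cong-≗ λ v → trans
      (if-then-0 (adj G (vertex G u) (vertex G v)) _)
      (cong (⟦ adj G (vertex G u) (vertex G v) ⟧ *_) (cong₂ _*_ (degree≡ u) (degree≡ v))))

  zagreb-equality : 0 < order G → 0 < total-deg G →
                    order G * total-adj G ≡ total-deg G * total-deg² G → Graph.ZagrebEquality Γ
  zagreb-equality 0<n 0<Σdeg balance = record
    { order≢0  = >-nonZero 0<n
    ; size≢0   = size≢0
    ; equality = /-cong-* (Graph.M₁ Γ) (order G) (Graph.M₂ Γ) m {{>-nonZero 0<n}} {{size≢0}}
                   -- `balance` is twice the cross-multiplied equality, as `total-deg` and
                   -- `total-adj` count every edge twice.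
                   (*-cancelˡ-≡ _ _ 2 (begin
                     2 * (Graph.M₁ Γ * m)           ≡⟨ double₁ (Graph.M₁ Γ) m ⟩
                     (m + m) * Graph.M₁ Γ           ≡⟨ cong₂ _*_ double-size M₁≡ ⟩
                     total-deg G * total-deg² G     ≡⟨ balance ⟨
                     order G * total-adj G          ≡⟨ cong (order G *_) double-M₂ ⟨
                     order G * (Graph.M₂ Γ + Graph.M₂ Γ) ≡⟨ double₂ (order G) (Graph.M₂ Γ) ⟩
                     2 * (Graph.M₂ Γ * order G)     ∎))
    }
    where
    m = Graph.size Γ
    size≢0 : NonZero m
    size≢0 with m | double-size
    ... | zero  | 0≡Σdeg = ⊥-elim (<-irrefl 0≡Σdeg 0<Σdeg)
    ... | suc _ | _      = _
    double₁ : ∀ x y → 2 * (x * y) ≡ (y + y) * x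
    double₁ = solve-∀
    double₂ : ∀ n x → n * (x + x) ≡ 2 * (x * n)
    double₂ = solve-∀

-- The choice of the parameters

-- With Δ = 5 + c and f = 2g, one less than the x that solves 2x = 6(Δ-3)²f + 80.
lensCount : ℕ → ℕ → ℕ
lensCount c g = 6 * ((2 + c) * (2 + c)) * g + 39

-- Its successor is a quarter of the part free of y in the difference of the two sides; in terms of
-- g = f/2 no division remains.
diamondCount : ℕ → ℕ → ℕ → ℕ
diamondCount c g x =
  (11 * (c * c) + 43 * c + 40) * (g * x) + 2 * (5 + c) * ((2 + c) * (2 + c)) * (g * g)
  + 71 * x + (7 * ((5 + c) * (5 + c)) + 3 * (5 + c) + 6) * g + 2

-- With x lenses, f fans and y diamonds, the two sides differ by a polynomial that
-- is bilinear in x and y, and 2x is chosen so that the coefficient of y becomes −2.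
zagreb-balance : ∀ c g f x y →
  f ≡ 2 * g →
  x ≡ suc (lensCount c g) →
  y ≡ suc (diamondCount c g x) →
  (7 * x + f * (6 + c) + 4 * y + 3) * (200 * x + f * (6 * ((5 + c) * (8 + c))) + 108 * y + 12) ≡
  (20 * x + f * (4 * (5 + c)) + 12 * y + 4) * (70 * x + f * ((5 + c) * (14 + c)) + 36 * y + 6)
-- The term -4xy of the difference is moved to the left to stay in ℕ, and cancelled at the end. `x`
-- and `y` remain variables in `difference`; their values enter only through `X` and `Y`, which
-- keeps the polynomial identity small.
zagreb-balance c g f x y refl x≡ y≡ = +-cancelʳ-≡ (4 * (x * y)) lhs rhs (begin
  lhs + 4 * (x * y)                     ≡⟨ difference c g x y ⟩
  rhs + 2 * (coefficient * y + 2 * Y)   ≡⟨ cong (λ z → rhs + 2 * (coefficient * y + 2 * z)) y≡Y ⟨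
  rhs + 2 * (coefficient * y + 2 * y)   ≡⟨ cong (rhs +_) (factor coefficient y) ⟩
  rhs + 2 * ((coefficient + 2) * y)     ≡⟨ cong (λ z → rhs + 2 * (z * y)) (trans (cong (2 *_) x≡X) (double c g)) ⟨
  rhs + 2 * (2 * x * y)                 ≡⟨ cong (rhs +_) (four x y) ⟩
  rhs + 4 * (x * y)                     ∎)
  where
  lhs = (7 * x + 2 * g * (6 + c) + 4 * y + 3) * (200 * x + 2 * g * (6 * ((5 + c) * (8 + c))) + 108 * y + 12)
  rhs = (20 * x + 2 * g * (4 * (5 + c)) + 12 * y + 4) * (70 * x + 2 * g * ((5 + c) * (14 + c)) + 36 * y + 6)
  coefficient = 12 * ((2 + c) * (2 + c)) * g + 78
  Y = suc ((11 * (c * c) + 43 * c + 40) * (g * x) + 2 * (5 + c) * ((2 + c) * (2 + c)) * (g * g)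
           + 71 * x + (7 * ((5 + c) * (5 + c)) + 3 * (5 + c) + 6) * g + 2)
  X = suc (6 * ((2 + c) * (2 + c)) * g + 39)
  x≡X : x ≡ X
  x≡X = x≡
  y≡Y : y ≡ Y
  y≡Y = y≡
  difference : ∀ c g x y →
    (7 * x + 2 * g * (6 + c) + 4 * y + 3) * (200 * x + 2 * g * (6 * ((5 + c) * (8 + c))) + 108 * y + 12)
    + 4 * (x * y) ≡
    (20 * x + 2 * g * (4 * (5 + c)) + 12 * y + 4) * (70 * x + 2 * g * ((5 + c) * (14 + c)) + 36 * y + 6)
    + 2 * ((12 * ((2 + c) * (2 + c)) * g + 78) * y +
           2 * suc ((11 * (c * c) + 43 * c + 40) * (g * x) + 2 * (5 + c) * ((2 + c) * (2 + c)) * (g * g)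
                    + 71 * x + (7 * ((5 + c) * (5 + c)) + 3 * (5 + c) + 6) * g + 2))
  difference = solve-∀
  factor : ∀ k y → 2 * (k * y + 2 * y) ≡ 2 * ((k + 2) * y)
  factor = solve-∀
  double : ∀ c g → 2 * suc (6 * ((2 + c) * (2 + c)) * g + 39) ≡ 12 * ((2 + c) * (2 + c)) * g + 78 + 2
  double = solve-∀
  four : ∀ x y → 2 * (2 * x * y) ≡ 4 * (x * y)
  four = solve-∀

-- The infinite family for Δ = 5 + c

module Family (c : ℕ) where

  lenses fans diamonds : ℕ → ℕ
  lenses i   = lensCount c (suc i)
  fans i     = suc (i + i)
  diamonds i = diamondCount c (suc i) (suc (lenses i))

  -- The parameter `4 + c` gives the fans hubs of degree `5 + c`. The number of fans is
  -- `suc (fans i)`, that is 2g with g = `suc i`.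
  member : ℕ → Chain 0 1 1 0
  member i = caterpillar (4 + c) (lenses i) (fans i) (diamonds i)

  member-stats : ∀ i → Stats (member i) _ _ _ _ 1 1
  member-stats i = caterpillar-stats (4 + c) (lenses i) (fans i) (diamonds i)

  balance : ∀ i → order (member i) * total-adj (member i) ≡ total-deg (member i) * total-deg² (member i)
  balance i = trans (cong₂ _*_ order≡ total-adj≡)
    (trans (zagreb-balance c (suc i) (suc (fans i)) (suc (lenses i)) (suc (diamonds i))
             (cong suc (trans (sym (+-suc i i)) (cong (λ z → i + suc z) (sym (+-identityʳ i)))))
             refl refl)
           (sym (cong₂ _*_ total-deg≡ total-deg²≡)))
    where open Stats (member-stats i)

  0<order : ∀ i → 0 < order (member i)
  0<order i = s≤s z≤n

  0<total-deg : ∀ i → 0 < total-deg (member i)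
  0<total-deg i = s≤s z≤n

  lenses-mono-≤ : ∀ {i j} → i ≤ j → lenses i ≤ lenses j
  lenses-mono-≤ i≤j = +-monoˡ-≤ 39 (*-monoʳ-≤ (6 * ((2 + c) * (2 + c))) (s≤s i≤j))

  fans-mono-< : ∀ {i j} → i < j → fans i < fans j
  fans-mono-< i<j = s≤s (+-mono-< i<j i<j)

  diamonds-mono-≤ : ∀ {i j} → i ≤ j → diamonds i ≤ diamonds j
  diamonds-mono-≤ i≤j = +-monoˡ-≤ 2 (+-mono-≤ (+-mono-≤ (+-mono-≤
    (*-monoʳ-≤ (11 * (c * c) + 43 * c + 40) (*-mono-≤ (s≤s i≤j) (s≤s (lenses-mono-≤ i≤j))))
    (*-monoʳ-≤ (2 * (5 + c) * ((2 + c) * (2 + c))) (*-mono-≤ (s≤s i≤j) (s≤s i≤j))))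
    (*-monoʳ-≤ 71 (s≤s (lenses-mono-≤ i≤j))))
    (*-monoʳ-≤ (7 * ((5 + c) * (5 + c)) + 3 * (5 + c) + 6) (s≤s i≤j)))

  -- The number of fans grows strictly, and those of lenses and diamonds do not decrease. The order
  -- thus tells the members apart up to isomorphism.
  order-mono-< : ∀ {i j} → i < j → order (member i) < order (member j)
  order-mono-< {i} {j} i<j = subst₂ _<_
    (sym (Stats.order≡ (member-stats i))) (sym (Stats.order≡ (member-stats j)))
    (+-monoˡ-< 3 (+-mono-<-≤ (+-mono-≤-<
      (*-monoʳ-≤ 7 (s≤s (lenses-mono-≤ i≤j)))
      (*-monoˡ-< (6 + c) (s≤s (fans-mono-< i<j))))
      (*-monoʳ-≤ 4 (s≤s (diamonds-mono-≤ i≤j)))))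
    where i≤j = <⇒≤ i<j

  order-injective : ∀ {i j} → order (member i) ≡ order (member j) → i ≡ j
  order-injective {i} {j} eq with <-cmp i j
  ... | tri< i<j _ _ = ⊥-elim (<-irrefl eq (order-mono-< i<j))
  ... | tri≈ _ i≡j _ = i≡j
  ... | tri> _ _ j<i = ⊥-elim (<-irrefl (sym eq) (order-mono-< j<i))

  not-isomorphic : ∀ i j → i ≢ j → ¬ (graph (member i) ≅ graph (member j))
  not-isomorphic i j i≢j iso = i≢j (order-injective (↔⇒≡ (_≅_.bijection iso)))

  deg-fan-≤ : ∀ k → 3 ≤ suc k → ∀ v → deg (fan k) v ≤ suc k
  deg-fan-≤ k 3≤ (inj₁ _) = ≤-reflexive (order-path k)
  deg-fan-≤ k 3≤ (inj₂ v) = subst (λ d → suc d ≤ suc k) (sym (iterate-deg (_≡ 2) k (λ _ → refl) v)) 3≤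

  -- The degree 5 inside the lenses is what the assumption 5 ≤ Δ makes room for.
  deg-lens-≤ : ∀ v → deg lens v ≤ 5
  deg-lens-≤ (inj₁ _)               = m≤m+n 2 3
  deg-lens-≤ (inj₂ (inj₁ _))        = ≤-refl
  deg-lens-≤ (inj₂ (inj₂ (inj₁ _))) = m≤m+n 2 3
  deg-lens-≤ (inj₂ (inj₂ (inj₂ _))) = ≤-refl

  deg-member-≤ : ∀ i v → deg (member i) v ≤ 5 + c
  deg-member-≤ i (inj₁ _) = s≤s z≤n
  deg-member-≤ i (inj₂ (inj₁ v)) =
    iterate-deg (_≤ 5 + c) (lenses i) (λ v → ≤-trans (deg-lens-≤ v) (m≤m+n 5 c)) v
  deg-member-≤ i (inj₂ (inj₂ (inj₁ v))) =
    iterate-deg (_≤ 5 + c) (fans i) (deg-fan-≤ (4 + c) (m≤m+n 3 (2 + c))) v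
  deg-member-≤ i (inj₂ (inj₂ (inj₂ (inj₁ v)))) =
    iterate-deg (_≤ 5 + c) (diamonds i) (λ v → ≤-trans (deg-fan-≤ 2 ≤-refl v) (m≤m+n 3 (2 + c))) v
  deg-member-≤ i (inj₂ (inj₂ (inj₂ (inj₂ (inj₁ _))))) = m≤m+n 2 (3 + c)
  deg-member-≤ i (inj₂ (inj₂ (inj₂ (inj₂ (inj₂ _))))) = s≤s z≤n

  module _ (i : ℕ) where

    private
      G = member i

    -- The last three lie in the first fan. `leaf` and `hub` have degrees 1 and Δ, which excludes
    -- regularity; `rim` and `rim′` are adjacent and both of degree 3, which excludes class 1.
    leaf hub rim rim′ : Vertex G
    leaf = inj₁ zero
    hub  = inj₂ (inj₂ (inj₁ (inj₁ (inj₁ zero))))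
    rim  = inj₂ (inj₂ (inj₁ (inj₁ (inj₂ (inj₁ zero)))))
    rim′ = inj₂ (inj₂ (inj₁ (inj₁ (inj₂ (inj₂ (inj₁ zero))))))

    degree-hub : Graph.degree (graph G) (index G hub) ≡ 5 + c
    degree-hub = trans (degree-index G hub) (order-path (4 + c))

    maximum-degree : Graph.MaximumDegree (graph G) (5 + c)
    maximum-degree =
      (λ v → subst (_≤ 5 + c) (sym (degree≡ G v)) (deg-member-≤ i (vertex G v))) ,
      index G hub , degree-hub

    not-regular : ¬ Graph.Regular (graph G)
    not-regular regular = 1≢5+c (trans (sym (degree-index G leaf))
      (trans (regular (index G leaf) (index G hub)) degree-hub))
      where
      1≢5+c : 1 ≢ 5 + c
      1≢5+c ()

    not-class-1 : ¬ Graph.BiregularClass1 (graph G)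
    not-class-1 (_ , no-equal-neighbours) = no-equal-neighbours (index G rim) (index G rim′)
      (subst₂ (Adjacent G) (sym (vertex-index G rim)) (sym (vertex-index G rim′)) _)
      (trans (degree-index G rim) (sym (degree-index G rim′)))

theorem2p1 : (Δ : ℕ) → 5 ≤ Δ →
    Σ[ G ∈ (ℕ → Graph) ]
    (∀ i j → i ≢ j → ¬ (G i ≅ G j))
    × (∀ i → Graph.Connected (G i)
    × Graph.MaximumDegree (G i) Δ
    × ¬ Graph.Regular (G i)
    × ¬ Graph.BiregularClass1 (G i)
    × Graph.ZagrebEquality (G i))
-- Writing Δ as `5 + c` keeps all polynomials in the parameters free of subtraction.
theorem2p1 Δ 5≤Δ with c , refl ← m≤n⇒∃[o]m+o≡n 5≤Δ =
  graph ∘ member , not-isomorphic , λ i →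
    graph-connected (member i) , maximum-degree i , not-regular i , not-class-1 i ,
    zagreb-equality (member i) (0<order i) (0<total-deg i) (balance i)
  where open Family c
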